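{- Let $\Delta$ be a finite non-empty simplicial complex on the vertex set $[n]$, let $i\in[n]$, and let $\mathfrak{I}\subseteq\mathbb{R}_\Delta$ be a cone of cooperative games that contains the carrier games $v_T$ (for non-empty $T\in\operatorname{St}_\Delta i$) and $\hat v_T$ (for all $T\in \operatorname{St}_\Delta i$). Let $\phi_i:\mathfrak{I}\to\mathbb{R}$ be an individual value that can be written as $$\phi_i(v)=\sum_{T\in \operatorname{Lk}_\Delta i}p_T\left(v(T\cup i)-v(T)\right)\qquad(v\in\mathfrak I)$$ with real numbers $p_T$ satisfying $\sum_{T\in \operatorname{Lk}_\Delta i} p_T=1$, and assume that $\phi_i$ satisfies the monotonicity axiom. Then the constants $\{p_T\}_{T\in\operatorname{Lk}_\Delta i}$ form a probability distribution on $\operatorname{Lk}_\Delta i$.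
   Context: $[n]=\{1,\dots,n\}$. A simplicial complex $\Delta$ on $[n]$ is a family of subsets of $[n]$ closed under taking subsets; $[n]$ is its set of vertices (players). We write $T\cup i$ for $T\cup\{i\}$. A cooperative game on $\Delta$ is a function $v:\Delta\to\mathbb{R}$ with $v(\emptyset)=0$; $\mathbb{R}_\Delta$ is the real vector space of all such functions. A cone $\mathfrak{I}\subseteq\mathbb{R}_\Delta$ is a subset closed under multiplication by positive scalars. An individual value for player $i$ is a function $\phi_i:\mathfrak{I}\to\mathbb{R}$. Star of $i$: $\operatorname{St}_\Delta i=\{A : A\subseteq T \text{ for some } T\in\Delta \text{ with } i\in T\}$. Link of $i$: $\operatorname{Lk}_\Delta i=\{T\in\Delta : i\notin T,\ T\cup i\in\Delta\}$. Carrier games: for $\emptyset\neq T\in\Delta$ and $S\in\Delta$, $v_T(S)=1$ if $T\subseteq S$ and $0$ otherwise; for $T\in\Delta$ (including $T=\emptyset$), $\hat v_T(S)=1$ if $T\subsetneq S$ and $0$ otherwise. A game $v$ is monotone if $v(S)\le v(T)$ whenever $S\subseteq T\in\Delta$. Monotonicity axiom: $\phi_i(v)\ge 0$ for every monotone $v\in\mathfrak I$. -}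

module Defs where

open import Data.Bool.Base using (if_then_else_)
open import Data.Fin.Base using (Fin)
open import Data.Fin.Subset
  using (Subset; inside; outside; _∈_; _∉_; _⊆_; _⊂_; _∪_; ⁅_⁆; ⊥; Nonempty)
open import Data.Fin.Subset.Properties using (_∈?_; _⊆?_; _⊂?_; ∉⊥)
open import Data.Irrelevant using ([_])
open import Data.List.Base as List using (List; []; _∷_; _++_; foldr; mapMaybe)
import Data.Maybe.Base as Maybe
open import Data.Nat.Base as ℕ using (ℕ; zero; suc)
import Data.Nat.Properties as ℕ
open import Data.Product.Base using (∃; _×_; _,_; proj₁; proj₂)
open import Data.Rational.Base as ℚ using (ℚ; 0ℚ; 1ℚ; ½; ∣_∣; 1/_)
import Data.Rational.Properties as ℚ
open import Data.Rational.Solver using (module +-*-Solver)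
open import Data.Refinement.Base as Refinement
  using (Refinement-syntax; value; refine) renaming (_,_ to _,ᵣ_)
open import Data.Vec.Base using ([]; _∷_)
open import Function.Bundles using (Func)
open import Level using (Level; 0ℓ) renaming (suc to lsuc)
open import Relation.Binary.Bundles using (Setoid)
open import Relation.Binary.Definitions using (_Respects_)
open import Relation.Binary.PropositionalEquality
  using (_≡_; refl; sym; trans; cong; subst)
import Relation.Binary.Construct.On as On
open import Relation.Nullary using (Dec; yes; no; does; ¬?; contradiction)
open import Relation.Nullary.Decidable using (_×-dec_; dec⇒maybe)
open import Relation.Unary using (Pred; Decidable)

private
  variable
    a ℓ : Level
    A : Set a
    n : ℕ

-- A real number is a Cauchy sequence of rationals; equality _≃_ of reals is
-- convergence of the difference to zero.

Cauchy : (ℕ → ℚ) → Set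
Cauchy x = ∀ ε → 0ℚ ℚ.< ε →
  ∃ λ N → ∀ j k → N ℕ.≤ j → N ℕ.≤ k → ∣ x j ℚ.- x k ∣ ℚ.< ε

record ℝ : Set where
  constructor mkℝ
  field
    seq    : ℕ → ℚ
    cauchy : Cauchy seq

open ℝ public

infix 4 _≃_ _≤_ _<_

_≃_ : ℝ → ℝ → Set
x ≃ y = ∀ ε → 0ℚ ℚ.< ε →
  ∃ λ N → ∀ k → N ℕ.≤ k → ∣ seq x k ℚ.- seq y k ∣ ℚ.< ε

-- The slack ε is needed because the order on representatives is not
-- invariant under adding null sequences.
_≤_ : ℝ → ℝ → Set
x ≤ y = ∀ ε → 0ℚ ℚ.< ε →
  ∃ λ N → ∀ k → N ℕ.≤ k → seq x k ℚ.≤ seq y k ℚ.+ ε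

_<_ : ℝ → ℝ → Set
x < y = ∃ λ ε → 0ℚ ℚ.< ε ×
  ∃ λ N → ∀ k → N ℕ.≤ k → seq x k ℚ.+ ε ℚ.≤ seq y k

private
  module S = +-*-Solver

  ½+½ : ∀ ε → ½ ℚ.* ε ℚ.+ ½ ℚ.* ε ≡ ε
  ½+½ = S.solve 1 (λ e → S.con ½ S.:* e S.:+ S.con ½ S.:* e S.:= e) refl

  +-interchange : ∀ a b c d →
    (a ℚ.+ b) ℚ.- (c ℚ.+ d) ≡ (a ℚ.- c) ℚ.+ (b ℚ.- d)
  +-interchange = S.solve 4 (λ a b c d →
    (a S.:+ b) S.:- (c S.:+ d) S.:= (a S.:- c) S.:+ (b S.:- d)) refl

  *-difference : ∀ a b c d →
    a ℚ.* b ℚ.- c ℚ.* d ≡ a ℚ.* (b ℚ.- d) ℚ.+ d ℚ.* (a ℚ.- c)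
  *-difference = S.solve 4 (λ a b c d →
    a S.:* b S.:- c S.:* d S.:= a S.:* (b S.:- d) S.:+ d S.:* (a S.:- c)) refl

  *-minus-0 : ∀ a b → a ℚ.* (b ℚ.- 0ℚ) ≡ a ℚ.* b ℚ.- 0ℚ
  *-minus-0 = S.solve 2 (λ a b →
    a S.:* (b S.:- S.con 0ℚ) S.:= a S.:* b S.:- S.con 0ℚ) refl

  neg-difference : ∀ a b → b ℚ.- a ≡ ℚ.- a ℚ.- (ℚ.- b)
  neg-difference = S.solve 2 (λ a b →
    b S.:- a S.:= S.:- a S.:- (S.:- b)) refl

  neg-swap : ∀ a b → ℚ.- (a ℚ.- b) ≡ b ℚ.- a
  neg-swap = S.solve 2 (λ a b → S.:- (a S.:- b) S.:= b S.:- a) refl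

  add-difference : ∀ a b → a ℚ.+ (b ℚ.- a) ≡ b
  add-difference = S.solve 2 (λ a b → a S.:+ (b S.:- a) S.:= b) refl

  telescope : ∀ a b c → a ℚ.- c ≡ (a ℚ.- b) ℚ.+ (b ℚ.- c)
  telescope = S.solve 3 (λ a b c →
    a S.:- c S.:= (a S.:- b) S.:+ (b S.:- c)) refl

  *-pos : ∀ {p q} → 0ℚ ℚ.< p → 0ℚ ℚ.< q → 0ℚ ℚ.< p ℚ.* q
  *-pos {p} {q} 0<p 0<q =
    subst (ℚ._< p ℚ.* q) (ℚ.*-zeroʳ p)
      (ℚ.*-monoʳ-<-pos p {{ℚ.positive 0<p}} 0<q)

  half-pos : ∀ {ε} → 0ℚ ℚ.< ε → 0ℚ ℚ.< ½ ℚ.* ε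
  half-pos = *-pos (ℚ.positive⁻¹ ½)

  add-small : ∀ {ε} s t {p} → p ≡ s ℚ.+ t →
    ∣ s ∣ ℚ.< ½ ℚ.* ε → ∣ t ∣ ℚ.< ½ ℚ.* ε → ∣ p ∣ ℚ.< ε
  add-small {ε} s t refl s< t< =
    ℚ.≤-<-trans (ℚ.∣p+q∣≤∣p∣+∣q∣ s t)
      (subst (∣ s ∣ ℚ.+ ∣ t ∣ ℚ.<_) (½+½ ε) (ℚ.+-mono-< s< t<))

  ∣p-p∣≡0 : ∀ p → ∣ p ℚ.- p ∣ ≡ 0ℚ
  ∣p-p∣≡0 p = cong ∣_∣ (ℚ.+-inverseʳ p)

  ∣p-q∣≡∣q-p∣ : ∀ p q → ∣ p ℚ.- q ∣ ≡ ∣ q ℚ.- p ∣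
  ∣p-q∣≡∣q-p∣ p q = trans (sym (ℚ.∣-p∣≡∣p∣ (p ℚ.- q))) (cong ∣_∣
    (neg-swap p q))

  bounded : ∀ {x} → Cauchy x →
    ∃ λ B → 0ℚ ℚ.< B × ∃ λ N → ∀ k → N ℕ.≤ k → ∣ x k ∣ ℚ.≤ B
  bounded {x} cx with cx 1ℚ (ℚ.positive⁻¹ 1ℚ)
  ... | N , close =
    ∣ x N ∣ ℚ.+ 1ℚ
    , ℚ.+-mono-≤-< (ℚ.0≤∣p∣ (x N)) (ℚ.positive⁻¹ 1ℚ)
    , N , λ k N≤k → ℚ.≤-trans
        (subst (λ q → ∣ q ∣ ℚ.≤ ∣ x N ∣ ℚ.+ ∣ x k ℚ.- x N ∣)
          (add-difference (x N) (x k))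
          (ℚ.∣p+q∣≤∣p∣+∣q∣ (x N) (x k ℚ.- x N)))
        (ℚ.+-monoʳ-≤ ∣ x N ∣ (ℚ.<⇒≤ (close k N N≤k ℕ.≤-refl)))

  scale-small : ∀ B → 0ℚ ℚ.< B → ∀ ε → 0ℚ ℚ.< ε →
    ∃ λ δ → 0ℚ ℚ.< δ × (∀ p q → ∣ p ∣ ℚ.≤ B → ∣ q ∣ ℚ.< δ → ∣ p ℚ.* q ∣ ℚ.< ε)
  scale-small B 0<B ε 0<ε =
    δ , *-pos (ℚ.positive⁻¹ (1/ B) {{ℚ.1/pos⇒pos B}}) 0<ε , bound
    where
    instance
      B-pos : ℚ.Positive B
      B-pos = ℚ.positive 0<B
      B-nonZero : ℚ.NonZero B
      B-nonZero = ℚ.pos⇒nonZero B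
    δ = 1/ B ℚ.* ε
    Bδ≡ε : B ℚ.* δ ≡ ε
    Bδ≡ε = trans (sym (ℚ.*-assoc B (1/ B) ε))
      (trans (cong (ℚ._* ε) (ℚ.*-inverseʳ B)) (ℚ.*-identityˡ ε))
    bound : ∀ p q → ∣ p ∣ ℚ.≤ B → ∣ q ∣ ℚ.< δ → ∣ p ℚ.* q ∣ ℚ.< ε
    bound p q p≤B q<δ = subst (ℚ._< ε) (sym (ℚ.∣p*q∣≡∣p∣*∣q∣ p q))
      (ℚ.≤-<-trans
        (ℚ.*-monoʳ-≤-nonNeg ∣ q ∣ {{ℚ.∣-∣-nonNeg q}} p≤B)
        (subst (B ℚ.* ∣ q ∣ ℚ.<_) Bδ≡ε (ℚ.*-monoʳ-<-pos B q<δ)))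

  *-close : ∀ {B C δ η} ε →
    (∀ p q → ∣ p ∣ ℚ.≤ B → ∣ q ∣ ℚ.< δ → ∣ p ℚ.* q ∣ ℚ.< ½ ℚ.* ε) →
    (∀ p q → ∣ p ∣ ℚ.≤ C → ∣ q ∣ ℚ.< η → ∣ p ℚ.* q ∣ ℚ.< ½ ℚ.* ε) →
    ∀ a b c d → ∣ a ∣ ℚ.≤ B → ∣ d ∣ ℚ.≤ C →
    ∣ b ℚ.- d ∣ ℚ.< δ → ∣ a ℚ.- c ∣ ℚ.< η → ∣ a ℚ.* b ℚ.- c ℚ.* d ∣ ℚ.< ε
  *-close ε f g a b c d a≤B d≤C b-d<δ a-c<η =
    add-small {ε} (a ℚ.* (b ℚ.- d)) (d ℚ.* (a ℚ.- c))
      {a ℚ.* b ℚ.- c ℚ.* d} (*-difference a b c d)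
      (f a (b ℚ.- d) a≤B b-d<δ) (g d (a ℚ.- c) d≤C a-c<η)

  *-cauchy : ∀ {x y} → Cauchy x → Cauchy y → Cauchy (λ k → x k ℚ.* y k)
  *-cauchy {x} {y} cx cy ε 0<ε =
    let B , 0<B , K , x≤B = bounded {x} cx
        C , 0<C , L , y≤C = bounded {y} cy
        δ , 0<δ , f = scale-small B 0<B (½ ℚ.* ε) (half-pos {ε} 0<ε)
        η , 0<η , g = scale-small C 0<C (½ ℚ.* ε) (half-pos {ε} 0<ε)
        M , hy = cy δ 0<δ
        N , hx = cx η 0<η
        KL = K ℕ.⊔ L
        MN = M ℕ.⊔ N
    in KL ℕ.⊔ MN , λ j k j≥ k≥ →
      let j≥MN = ℕ.m⊔n≤o⇒n≤o KL MN j≥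
          k≥MN = ℕ.m⊔n≤o⇒n≤o KL MN k≥
      in *-close {B} {C} {δ} {η} ε f g (x j) (y j) (x k) (y k)
        (x≤B j (ℕ.m⊔n≤o⇒m≤o K L (ℕ.m⊔n≤o⇒m≤o KL MN j≥)))
        (y≤C k (ℕ.m⊔n≤o⇒n≤o K L (ℕ.m⊔n≤o⇒m≤o KL MN k≥)))
        (hy j k (ℕ.m⊔n≤o⇒m≤o M N j≥MN) (ℕ.m⊔n≤o⇒m≤o M N k≥MN))
        (hx j k (ℕ.m⊔n≤o⇒n≤o M N j≥MN) (ℕ.m⊔n≤o⇒n≤o M N k≥MN))

infixl 6 _+_ _-_
infixl 7 _*_
infix  8 -_

fromℚ : ℚ → ℝ
fromℚ q = mkℝ (λ _ → q) λ ε 0<ε →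
  0 , λ _ _ _ _ → subst (ℚ._< ε) (sym (∣p-p∣≡0 q)) 0<ε

0ℝ 1ℝ : ℝ
0ℝ = fromℚ 0ℚ
1ℝ = fromℚ 1ℚ

_+_ : ℝ → ℝ → ℝ
x + y = mkℝ (λ k → seq x k ℚ.+ seq y k) isCauchy
  where
  isCauchy : Cauchy (λ k → seq x k ℚ.+ seq y k)
  isCauchy ε 0<ε
    with cauchy x (½ ℚ.* ε) (half-pos 0<ε) | cauchy y (½ ℚ.* ε) (half-pos 0<ε)
  ... | M , hx | N , hy = M ℕ.⊔ N , λ j k j≥ k≥ →
    add-small (seq x j ℚ.- seq x k) (seq y j ℚ.- seq y k)
      (+-interchange (seq x j) (seq y j) (seq x k) (seq y k))
      (hx j k (ℕ.m⊔n≤o⇒m≤o M N j≥) (ℕ.m⊔n≤o⇒m≤o M N k≥))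
      (hy j k (ℕ.m⊔n≤o⇒n≤o M N j≥) (ℕ.m⊔n≤o⇒n≤o M N k≥))

-_ : ℝ → ℝ
- x = mkℝ (λ k → ℚ.- seq x k) isCauchy
  where
  isCauchy : Cauchy (λ k → ℚ.- seq x k)
  isCauchy ε 0<ε with cauchy x ε 0<ε
  ... | N , h = N , λ j k j≥ k≥ → subst (ℚ._< ε)
    (cong ∣_∣ (neg-difference (seq x j) (seq x k)))
    (h k j k≥ j≥)

_-_ : ℝ → ℝ → ℝ
x - y = x + (- y)

_*_ : ℝ → ℝ → ℝ
x * y = mkℝ (λ k → seq x k ℚ.* seq y k)
  (*-cauchy {seq x} {seq y} (cauchy x) (cauchy y))

≃-refl : ∀ {x} → x ≃ x
≃-refl {x} ε 0<ε = 0 , λ k _ → subst (ℚ._< ε) (sym (∣p-p∣≡0 (seq x k))) 0<ε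

≃-sym : ∀ {x y} → x ≃ y → y ≃ x
≃-sym {x} {y} x≃y ε 0<ε with x≃y ε 0<ε
... | N , h = N , λ k k≥ →
  subst (ℚ._< ε) (∣p-q∣≡∣q-p∣ (seq x k) (seq y k)) (h k k≥)

≃-trans : ∀ {x y z} → x ≃ y → y ≃ z → x ≃ z
≃-trans {x} {y} {z} x≃y y≃z ε 0<ε
  with x≃y (½ ℚ.* ε) (half-pos 0<ε) | y≃z (½ ℚ.* ε) (half-pos 0<ε)
... | M , hxy | N , hyz = M ℕ.⊔ N , λ k k≥ →
  add-small (seq x k ℚ.- seq y k) (seq y k ℚ.- seq z k)
    (telescope (seq x k) (seq y k) (seq z k))
    (hxy k (ℕ.m⊔n≤o⇒m≤o M N k≥)) (hyz k (ℕ.m⊔n≤o⇒n≤o M N k≥))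

ℝ-setoid : Setoid 0ℓ 0ℓ
ℝ-setoid = record
  { Carrier       = ℝ
  ; _≈_           = _≃_
  ; isEquivalence = record
    { refl  = λ {x} → ≃-refl {x}
    ; sym   = λ {x} {y} → ≃-sym {x} {y}
    ; trans = λ {x} {y} {z} → ≃-trans {x} {y} {z}
    }
  }

y≃0⇒x*y≃0 : ∀ x y → y ≃ 0ℝ → x * y ≃ 0ℝ
y≃0⇒x*y≃0 x y y≃0 ε 0<ε =
  let B , 0<B , M , x≤B = bounded {seq x} (cauchy x)
      δ , 0<δ , small = scale-small B 0<B ε 0<ε
      N , h = y≃0 δ 0<δ
  in M ℕ.⊔ N , λ k k≥ →
    subst (λ q → ∣ q ∣ ℚ.< ε) (*-minus-0 (seq x k) (seq y k))
      (small (seq x k) (seq y k ℚ.- 0ℚ)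
        (x≤B k (ℕ.m⊔n≤o⇒m≤o M N k≥)) (h k (ℕ.m⊔n≤o⇒n≤o M N k≥)))

∑ : List A → (A → ℝ) → ℝ
∑ xs f = foldr (λ x s → f x + s) 0ℝ xs

allSubsets : ∀ n → List (Subset n)
allSubsets zero    = [] ∷ []
allSubsets (suc n) =
  List.map (outside ∷_) (allSubsets n) ++ List.map (inside ∷_) (allSubsets n)

enumerate : {P : Pred (Subset n) 0ℓ} → Decidable P →
  List [ S ∈ Subset n ∣ P S ]
enumerate P? = mapMaybe
  (λ S → Maybe.map (λ PS → S ,ᵣ [ PS ]) (dec⇒maybe (P? S))) (allSubsets _)

-- The player set is Fin n; singletons are not required to be faces.  A family of subsets of a finite set is
-- classically always decidable; here decidability is part of the data.
record SimplicialComplex (n : ℕ) : Set₁ where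
  field
    IsFace     : Pred (Subset n) 0ℓ
    isFace?    : Decidable IsFace
    downClosed : ∀ {S T} → S ⊆ T → IsFace T → IsFace S

open SimplicialComplex public

-- Being a face is recorded irrelevantly, so that a function on faces
-- depends only on the underlying subset.
Face : SimplicialComplex n → Set
Face {n} Δ = [ S ∈ Subset n ∣ IsFace Δ S ]

NonEmptyComplex : SimplicialComplex n → Set
NonEmptyComplex Δ = ∃ λ T → IsFace Δ T

St : SimplicialComplex n → Fin n → Pred (Subset n) 0ℓ
St Δ i S = ∃ λ T → IsFace Δ T × i ∈ T × S ⊆ T

Lk : SimplicialComplex n → Fin n → Pred (Subset n) 0ℓ
Lk Δ i T = IsFace Δ T × i ∉ T × IsFace Δ (T ∪ ⁅ i ⁆)

lk? : (Δ : SimplicialComplex n) (i : Fin n) → Decidable (Lk Δ i)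
lk? Δ i T = isFace? Δ T ×-dec ¬? (i ∈? T) ×-dec isFace? Δ (T ∪ ⁅ i ⁆)

LinkFace : SimplicialComplex n → Fin n → Set
LinkFace {n} Δ i = [ T ∈ Subset n ∣ Lk Δ i T ]

module _ (Δ : SimplicialComplex n) (i : Fin n) where

  base : LinkFace Δ i → Face Δ
  base = refine proj₁

  join : LinkFace Δ i → Face Δ
  join = Refinement.map (_∪ ⁅ i ⁆) (λ l → proj₂ (proj₂ l))

∑Lk : (Δ : SimplicialComplex n) (i : Fin n) → (LinkFace Δ i → ℝ) → ℝ
∑Lk Δ i = ∑ (enumerate (lk? Δ i))

record Game (Δ : SimplicialComplex n) : Set where
  field
    worth   : Face Δ → ℝ
    worth-∅ : (f : IsFace Δ ⊥) → worth (⊥ ,ᵣ [ f ]) ≃ 0ℝ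

open Game public

gameSetoid : SimplicialComplex n → Setoid 0ℓ 0ℓ
gameSetoid Δ = record
  { Carrier       = Game Δ
  ; _≈_           = λ v w → ∀ S → worth v S ≃ worth w S
  ; isEquivalence = record
    { refl  = λ {v} S → ≃-refl {worth v S}
    ; sym   = λ {v} {w} e S → ≃-sym {worth v S} {worth w S} (e S)
    ; trans = λ {u} {v} {w} d e S →
        ≃-trans {worth u S} {worth v S} {worth w S} (d S) (e S)
    }
  }

infixr 7 _·_

_·_ : {Δ : SimplicialComplex n} → ℝ → Game Δ → Game Δ
worth   (c · v) S = c * worth v S
worth-∅ (c · v) f = y≃0⇒x*y≃0 c (worth v (⊥ ,ᵣ [ f ])) (worth-∅ v f)

Monotone : {Δ : SimplicialComplex n} → Game Δ → Set
Monotone {Δ = Δ} v =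
  ∀ (S T : Face Δ) → value S ⊆ value T → worth v S ≤ worth v T

indicator : {P : Set} → Dec P → ℝ
indicator P? = if does P? then 1ℝ else 0ℝ

carrierGame : (Δ : SimplicialComplex n) (T : Subset n) → Nonempty T → Game Δ
worth   (carrierGame Δ T ne) S = indicator (T ⊆? value S)
worth-∅ (carrierGame Δ T (j , j∈T)) f with T ⊆? ⊥
... | yes T⊆⊥ = contradiction (T⊆⊥ j∈T) ∉⊥
... | no  _   = ≃-refl {0ℝ}

strictCarrierGame : (Δ : SimplicialComplex n) (T : Subset n) → Game Δ
worth   (strictCarrierGame Δ T) S = indicator (T ⊂? value S)
worth-∅ (strictCarrierGame Δ T) f with T ⊂? ⊥
... | yes (_ , j , j∈⊥ , _) = contradiction j∈⊥ ∉⊥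
... | no  _                 = ≃-refl {0ℝ}

-- A subset of the setoid of games has to be closed under equality of games.
record Cone (Δ : SimplicialComplex n) (ℓ : Level) : Set (lsuc ℓ) where
  field
    Member   : Pred (Game Δ) ℓ
    respects : Member Respects (Setoid._≈_ (gameSetoid Δ))
    scale    : ∀ {c v} → 0ℝ < c → Member v → Member (c · v)

open Cone public

coneSetoid : {Δ : SimplicialComplex n} → Cone Δ ℓ → Setoid ℓ 0ℓ
coneSetoid {Δ = Δ} ℑ = On.setoid {B = ∃ (Member ℑ)} (gameSetoid Δ) proj₁

IndividualValue : {Δ : SimplicialComplex n} → Cone Δ ℓ → Set ℓ
IndividualValue ℑ = Func (coneSetoid ℑ) ℝ-setoid

MonotonicityAxiom : {Δ : SimplicialComplex n} (ℑ : Cone Δ ℓ) →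
  IndividualValue ℑ → Set ℓ
MonotonicityAxiom ℑ φ =
  ∀ v (v∈ℑ : Member ℑ v) → Monotone v → 0ℝ ≤ Func.to φ (v , v∈ℑ)

IsProbabilityDistribution : (Δ : SimplicialComplex n) (i : Fin n) →
  (LinkFace Δ i → ℝ) → Set
IsProbabilityDistribution Δ i p = (∀ T → 0ℝ ≤ p T) × ∑Lk Δ i p ≃ 1ℝ

{-# OPTIONS --safe #-}

-- For T in the link of i, the only S in the link for which the game v̂_T
-- distinguishes S ∪ i from S is T itself, so φ_i(v̂_T) = p_T; and v̂_T is
-- monotone.
module Submission where

open import Defs
open import Data.Bool.Base using (if_then_else_)
open import Data.Fin.Base using (Fin)
open import Data.Fin.Subset
  using (Subset; inside; outside; Nonempty; _∈_; _∉_; _⊆_; _⊂_; _∪_; ⁅_⁆)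
open import Data.Fin.Subset.Properties
  using (_∈?_; _⊂?_; ⊆-antisym; ⊂-⊆-trans; ⊂-irref; p⊆p∪q; q⊆p∪q; x∈p∪q⁻;
         x∈⁅x⁆; x∈⁅y⁆⇒x≡y)
open import Data.Irrelevant using ([_])
open import Data.List.Base as List using (List; []; _∷_; _++_; foldr; mapMaybe)
open import Data.List.Properties using (foldr-map)
open import Data.Maybe.Base as Maybe using (Maybe; just; nothing; maybe′)
import Data.Nat.Base as ℕ
import Data.Nat.Properties as ℕ
open import Data.Product.Base using (_,_)
open import Data.Rational.Base as ℚ using (ℚ; 0ℚ; 1ℚ; ½; ∣_∣)
import Data.Rational.Properties as ℚ
open import Data.Rational.Solver using (module +-*-Solver)
open import Data.Refinement.Base using (Refinement; value) renaming (_,_ to _,ᵣ_)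
open import Data.Sum.Base using (inj₁; inj₂)
open import Data.Vec.Base using ([]; _∷_)
open import Data.Vec.Properties using (∷-injectiveʳ)
open import Function.Base using (_∘_)
open import Function.Bundles using (Func; mk⇔)
open import Level using (Level; 0ℓ)
open import Relation.Binary.PropositionalEquality
  using (_≡_; _≢_; _≗_; refl; sym; trans; cong; cong₂; subst; module ≡-Reasoning)
open import Relation.Nullary
  using (Dec; yes; no; contradiction; contradiction-irr; recompute)
open import Relation.Nullary.Decidable
  using (dec⇒maybe; dec-true; dec-false; decidable-stable; does-⇔)
open import Relation.Unary using (Pred; Decidable)

-- The normalisation is assumed, so the point is the sign of each `p T`. Evaluate the value on the
-- strict carrier game v̂_T: it lies in the cone because T ⊆ T ∪ i puts T in the star of i, and it
-- is monotone because strict inclusion in S persists in every superset of S. For S in the link, i ∉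
-- T gives that T ⊊ S ∪ i holds exactly when T ⊊ S or S = T. Hence the marginal contribution of i is
-- 0 at every S ≠ T (`seq-marginal-off`) and 1 at S = T (`seq-marginal-on`), the sum over the link
-- collapses to `p T` (`∑Lk-strictCarrierGame`), and monotonicity reads 0 ≤ φ(v̂_T) = `p T`. The
-- collapse is computed in ℚ, one index of the Cauchy sequences at a time, where all the identities
-- are propositional; limits enter only when 0 ≤ φ(v̂_T) is carried along `_≃_`.

private
  module S = +-*-Solver

  variable
    a : Level
    A B : Set a
    n : ℕ.ℕ

p≤∣p∣ : ∀ p → p ℚ.≤ ∣ p ∣
p≤∣p∣ p with ℚ.≤-total 0ℚ p
... | inj₁ 0≤p = ℚ.≤-reflexive (sym (ℚ.0≤p⇒∣p∣≡p 0≤p))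
... | inj₂ p≤0 = ℚ.≤-trans p≤0 (ℚ.0≤∣p∣ p)

-- Half of the slack ε pays for the inequality, the other half for the distance between `y` and `z`.
≤-respʳ-≃ : ∀ {x y z} → x ≤ y → y ≃ z → x ≤ z
≤-respʳ-≃ {x} {y} {z} x≤y y≃z ε 0<ε
  with x≤y (½ ℚ.* ε) 0<½ε | y≃z (½ ℚ.* ε) 0<½ε
  where
  0<½ε : 0ℚ ℚ.< ½ ℚ.* ε
  0<½ε = subst (ℚ._< ½ ℚ.* ε) (ℚ.*-zeroʳ ½) (ℚ.*-monoʳ-<-pos ½ 0<ε)
... | M , hxy | N , hyz = M ℕ.⊔ N , λ k k≥ → begin
  seq x k
    ≤⟨ hxy k (ℕ.m⊔n≤o⇒m≤o M N k≥) ⟩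
  seq y k ℚ.+ ½ ℚ.* ε
    ≡⟨ split (seq y k) (seq z k) ε ⟩
  (seq y k ℚ.- seq z k) ℚ.+ (seq z k ℚ.+ ½ ℚ.* ε)
    ≤⟨ ℚ.+-monoˡ-≤ _ (ℚ.≤-trans (p≤∣p∣ _)
         (ℚ.<⇒≤ (hyz k (ℕ.m⊔n≤o⇒n≤o M N k≥)))) ⟩
  ½ ℚ.* ε ℚ.+ (seq z k ℚ.+ ½ ℚ.* ε)
    ≡⟨ join-halves (seq z k) ε ⟩
  seq z k ℚ.+ ε ∎
  where
  open ℚ.≤-Reasoning
  split : ∀ y z e → y ℚ.+ ½ ℚ.* e ≡ (y ℚ.- z) ℚ.+ (z ℚ.+ ½ ℚ.* e)
  split = S.solve 3 (λ y z e → y S.:+ S.con ½ S.:* e S.:=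
    (y S.:- z) S.:+ (z S.:+ S.con ½ S.:* e)) refl
  join-halves : ∀ z e → ½ ℚ.* e ℚ.+ (z ℚ.+ ½ ℚ.* e) ≡ z ℚ.+ e
  join-halves = S.solve 2 (λ z e →
    S.con ½ S.:* e S.:+ (z S.:+ S.con ½ S.:* e) S.:= z S.:+ e) refl

seq-≡⇒≃ : ∀ {x y} → seq x ≗ seq y → x ≃ y
seq-≡⇒≃ {x} {y} x≗y ε 0<ε = 0 , λ k _ → subst (λ q → ∣ q ∣ ℚ.< ε)
  (sym (trans (cong (ℚ._- seq y k) (x≗y k)) (ℚ.+-inverseʳ (seq y k)))) 0<ε

sum : List A → (A → ℚ) → ℚ
sum xs f = foldr (λ x s → f x ℚ.+ s) 0ℚ xs

seq-∑ : (xs : List A) (f : A → ℝ) →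
  ∀ k → seq (∑ xs f) k ≡ sum xs (λ x → seq (f x) k)
seq-∑ []       f k = refl
seq-∑ (x ∷ xs) f k = cong (seq (f x) k ℚ.+_) (seq-∑ xs f k)

sum-++ : (xs ys : List A) (f : A → ℚ) →
  sum (xs ++ ys) f ≡ sum xs f ℚ.+ sum ys f
sum-++ []       ys f = sym (ℚ.+-identityˡ (sum ys f))
sum-++ (x ∷ xs) ys f = trans (cong (f x ℚ.+_) (sum-++ xs ys f))
  (sym (ℚ.+-assoc (f x) (sum xs f) (sum ys f)))

sum-zero : (xs : List A) {f : A → ℚ} → (∀ x → f x ≡ 0ℚ) → sum xs f ≡ 0ℚ
sum-zero []       f≡0 = refl
sum-zero (x ∷ xs) f≡0 = cong₂ ℚ._+_ (f≡0 x) (sum-zero xs f≡0)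

-- Discarded entries may as well contribute 0; a sum over a filtered list thus becomes a sum of a
-- function extended by zero.
sum-mapMaybe : (g : A → Maybe B) (xs : List A) (f : B → ℚ) →
  sum (mapMaybe g xs) f ≡ sum xs (maybe′ f 0ℚ ∘ g)
sum-mapMaybe g []       f = refl
sum-mapMaybe g (x ∷ xs) f with g x
... | just y  = cong (f y ℚ.+_) (sum-mapMaybe g xs f)
... | nothing = trans (sum-mapMaybe g xs f)
  (sym (ℚ.+-identityˡ (sum xs (maybe′ f 0ℚ ∘ g))))

-- Induction on `T`: the half of the list whose head differs from that of `T` vanishes, and the
-- other half is the same problem for the tail.
sum-allSubsets-single : (T : Subset n) (f : Subset n → ℚ) →
  (∀ S → S ≢ T → f S ≡ 0ℚ) → sum (allSubsets n) f ≡ f T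
sum-allSubsets-single []      f _   = ℚ.+-identityʳ (f [])
sum-allSubsets-single {ℕ.suc n} (b ∷ T) f f≡0 = begin
  sum (List.map (outside ∷_) all ++ List.map (inside ∷_) all) f
    ≡⟨ sum-++ (List.map (outside ∷_) all) _ f ⟩
  sum (List.map (outside ∷_) all) f ℚ.+ sum (List.map (inside ∷_) all) f
    ≡⟨ cong₂ ℚ._+_ (foldr-map _ (outside ∷_) 0ℚ all)
         (foldr-map _ (inside ∷_) 0ℚ all) ⟩
  sum all (f ∘ (outside ∷_)) ℚ.+ sum all (f ∘ (inside ∷_))
    ≡⟨ by-head b f≡0 ⟩
  f (b ∷ T) ∎
  where
  open ≡-Reasoning
  all = allSubsets n
  -- The vanishing hypothesis is generalised together with `b`, so that once `b` is matched the
  -- wrong head is refuted by `λ ()`.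
  by-head : ∀ b → (∀ S → S ≢ b ∷ T → f S ≡ 0ℚ) →
    sum all (f ∘ (outside ∷_)) ℚ.+ sum all (f ∘ (inside ∷_)) ≡ f (b ∷ T)
  by-head outside f≡0 = trans
    (cong₂ ℚ._+_
      (sum-allSubsets-single T (f ∘ (outside ∷_))
        (λ S S≢T → f≡0 _ (S≢T ∘ ∷-injectiveʳ)))
      (sum-zero all (λ S → f≡0 _ λ ())))
    (ℚ.+-identityʳ _)
  by-head inside f≡0 = trans
    (cong₂ ℚ._+_
      (sum-zero all (λ S → f≡0 _ λ ()))
      (sum-allSubsets-single T (f ∘ (inside ∷_))
        (λ S S≢T → f≡0 _ (S≢T ∘ ∷-injectiveʳ))))
    (ℚ.+-identityˡ _)

module _ {P : Pred (Subset n) 0ℓ} (P? : Decidable P) where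

  sum-enumerate-single : (T : Refinement (Subset n) P)
    (f : Refinement (Subset n) P → ℚ) →
    (∀ S → value S ≢ value T → f S ≡ 0ℚ) →
    sum (enumerate P?) f ≡ f T
  sum-enumerate-single (T ,ᵣ [ PT ]) f f≡0 =
    trans (sum-mapMaybe select (allSubsets n) f)
      (trans (sum-allSubsets-single T _ off) on)
    where
    select : Subset n → Maybe (Refinement (Subset n) P)
    select S = Maybe.map (λ PS → S ,ᵣ [ PS ]) (dec⇒maybe (P? S))
    off : ∀ S → S ≢ T → maybe′ f 0ℚ (select S) ≡ 0ℚ
    off S S≢T with P? S
    ... | yes PS = f≡0 (S ,ᵣ [ PS ]) S≢T
    ... | no  _  = refl
    on : maybe′ f 0ℚ (select T) ≡ f (T ,ᵣ [ PT ])
    on with P? T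
    -- The membership proof found by `P?` may differ from `PT`, but it sits under irrelevance, so
    -- `f` cannot tell them apart.
    ... | yes _  = refl
    ... | no ¬PT = contradiction-irr PT ¬PT

-- As i ∉ T, removing i from the larger set keeps T ⊆ S; were this inclusion not strict, S would
-- equal T. Decidability of `_⊂_` and `_∈_` makes the argument by contradiction constructive.
∪⁅⁆-⊂⇒⊂ : ∀ {i} {S T : Subset n} → i ∉ T → S ≢ T → T ⊂ S ∪ ⁅ i ⁆ → T ⊂ S
∪⁅⁆-⊂⇒⊂ {i = i} {S} {T} i∉T S≢T (T⊆S∪i , _) =
  decidable-stable (T ⊂? S) λ T⊄S → S≢T (⊆-antisym
    (λ {x} x∈S → decidable-stable (x ∈? T) λ x∉T → T⊄S (T⊆S , x , x∈S , x∉T))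
    T⊆S)
  where
  T⊆S : T ⊆ S
  T⊆S {x} x∈T with x∈p∪q⁻ S ⁅ i ⁆ (T⊆S∪i x∈T)
  ... | inj₁ x∈S = x∈S
  ... | inj₂ x∈i =
    contradiction (subst (_∈ T) (x∈⁅y⁆⇒x≡y i x∈i) x∈T) i∉T

⊂-∪⁅⁆ : ∀ {i} {T : Subset n} → i ∉ T → T ⊂ T ∪ ⁅ i ⁆
⊂-∪⁅⁆ {i = i} {T} i∉T =
  p⊆p∪q ⁅ i ⁆ , i , q⊆p∪q T ⁅ i ⁆ (x∈⁅x⁆ i) , i∉T

fromℚ-mono-≤ : ∀ {p q} → p ℚ.≤ q → fromℚ p ≤ fromℚ q
fromℚ-mono-≤ {p} {q} p≤q ε 0<ε = 0 , λ _ _ →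
  subst (ℚ._≤ q ℚ.+ ε) (ℚ.+-identityʳ p) (ℚ.+-mono-≤ p≤q (ℚ.<⇒≤ 0<ε))

indicator-mono-≤ : {P Q : Set} (P? : Dec P) (Q? : Dec Q) → (P → Q) →
  indicator P? ≤ indicator Q?
indicator-mono-≤ (yes p) (no ¬q) f = contradiction (f p) ¬q
indicator-mono-≤ (yes _) (yes _) f = fromℚ-mono-≤ ℚ.≤-refl
indicator-mono-≤ (no _)  (yes _) f = fromℚ-mono-≤ (ℚ.nonNegative⁻¹ 1ℚ)
indicator-mono-≤ (no _)  (no _)  f = fromℚ-mono-≤ ℚ.≤-refl

strictCarrierGame-monotone : (Δ : SimplicialComplex n) (T : Subset n) →
  Monotone (strictCarrierGame Δ T)
strictCarrierGame-monotone Δ T S S′ S⊆S′ = indicator-mono-≤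
  (T ⊂? value S) (T ⊂? value S′) λ T⊂S → ⊂-⊆-trans T⊂S S⊆S′

module _ (Δ : SimplicialComplex n) (i : Fin n) (T : Subset n) where

  private
    v̂ = worth (strictCarrierGame Δ T)

  -- For S ≠ T the conditions T ⊊ S ∪ i and T ⊊ S are equivalent, so both indicators branch on the
  -- same boolean and cancel.
  seq-marginal-off : ∀ S → i ∉ T → value S ≢ T →
    ∀ k → seq (v̂ (join Δ i S) - v̂ (base Δ i S)) k ≡ 0ℚ
  seq-marginal-off S i∉T S≢T k = trans
    (cong (λ b → seq ((if b then 1ℝ else 0ℝ) - v̂ (base Δ i S)) k)
      (does-⇔ (mk⇔ (∪⁅⁆-⊂⇒⊂ i∉T S≢T) (λ T⊂S → ⊂-⊆-trans T⊂S (p⊆p∪q ⁅ i ⁆)))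
        (T ⊂? (value S ∪ ⁅ i ⁆)) (T ⊂? value S)))
    (ℚ.+-inverseʳ (seq (v̂ (base Δ i S)) k))

  seq-marginal-on : ∀ S → i ∉ T → value S ≡ T →
    ∀ k → seq (v̂ (join Δ i S) - v̂ (base Δ i S)) k ≡ 1ℚ
  seq-marginal-on S i∉T refl k = cong₂
    (λ b c → seq ((if b then 1ℝ else 0ℝ) - (if c then 1ℝ else 0ℝ)) k)
    (dec-true (T ⊂? (T ∪ ⁅ i ⁆)) (⊂-∪⁅⁆ i∉T))
    (dec-false (T ⊂? T) (⊂-irref refl))

-- A `LinkFace` holds its membership proof irrelevantly; deciding membership again yields one that
-- can be used.
linkFace-∈Lk : (Δ : SimplicialComplex n) (i : Fin n) (T : LinkFace Δ i) →
  Lk Δ i (value T)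
linkFace-∈Lk Δ i (T ,ᵣ [ T∈Lk ]) = recompute (lk? Δ i T) T∈Lk

∑Lk-single : (Δ : SimplicialComplex n) (i : Fin n)
  (f : LinkFace Δ i → ℝ) (T : LinkFace Δ i) {r : ℝ} →
  (∀ S → value S ≢ value T → ∀ k → seq (f S) k ≡ 0ℚ) →
  seq (f T) ≗ seq r → ∑Lk Δ i f ≃ r
∑Lk-single Δ i f T {r} f≡0 fT≡r = seq-≡⇒≃ {∑Lk Δ i f} {r} λ k →
  trans (seq-∑ (enumerate (lk? Δ i)) f k)
    (trans
      (sum-enumerate-single (lk? Δ i) T (λ S → seq (f S) k)
        (λ S S≢T → f≡0 S S≢T k))
      (fT≡r k))

∑Lk-strictCarrierGame : (Δ : SimplicialComplex n) (i : Fin n)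
  (p : LinkFace Δ i → ℝ) (T : LinkFace Δ i) → i ∉ value T →
  let v̂ = worth (strictCarrierGame Δ (value T)) in
  ∑Lk Δ i (λ S → p S * (v̂ (join Δ i S) - v̂ (base Δ i S))) ≃ p T
∑Lk-strictCarrierGame Δ i p T i∉T =
  let v̂ = worth (strictCarrierGame Δ (value T)) in
  ∑Lk-single Δ i (λ S → p S * (v̂ (join Δ i S) - v̂ (base Δ i S))) T {p T}
    (λ S S≢T k → trans
      (cong (seq (p S) k ℚ.*_) (seq-marginal-off Δ i (value T) S i∉T S≢T k))
      (ℚ.*-zeroʳ (seq (p S) k)))
    (λ k → trans
      (cong (seq (p T) k ℚ.*_) (seq-marginal-on Δ i (value T) T i∉T refl k))
      (ℚ.*-identityʳ (seq (p T) k)))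

theorem3 : ∀ {ℓ} n (Δ : SimplicialComplex n) → NonEmptyComplex Δ →
    (i : Fin n) (ℑ : Cone Δ ℓ) →
    (∀ T → St Δ i T → (ne : Nonempty T) → Member ℑ (carrierGame Δ T ne)) →
    (∀ T → St Δ i T → Member ℑ (strictCarrierGame Δ T)) →
    (φ : IndividualValue ℑ) (p : LinkFace Δ i → ℝ) →
    (∀ v (v∈ℑ : Member ℑ v) →
      Func.to φ (v , v∈ℑ)
        ≃ ∑Lk Δ i (λ T → p T * (worth v (join Δ i T) - worth v (base Δ i T)))) →
    ∑Lk Δ i p ≃ 1ℝ →
    MonotonicityAxiom ℑ φ →
    IsProbabilityDistribution Δ i p
theorem3 n Δ _ i ℑ _ v̂∈ℑ φ p φ≃∑ ∑p≃1 φ-mono = p-nonNeg , ∑p≃1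
  where
  p-nonNeg : ∀ T → 0ℝ ≤ p T
  p-nonNeg T =
    let t∈Δ , i∉t , t∪i∈Δ = linkFace-∈Lk Δ i T
        v̂  = strictCarrierGame Δ (value T)
        -- T ∪ i is the face containing i that witnesses T ∈ St.
        v̂∈ = v̂∈ℑ (value T) (value T ∪ ⁅ i ⁆ , t∪i∈Δ
               , q⊆p∪q (value T) ⁅ i ⁆ (x∈⁅x⁆ i) , p⊆p∪q ⁅ i ⁆)
        φv̂ = Func.to φ (v̂ , v̂∈)
        ∑v̂ = ∑Lk Δ i
               (λ S → p S * (worth v̂ (join Δ i S) - worth v̂ (base Δ i S)))
    in ≤-respʳ-≃ {0ℝ} {φv̂} {p T}
         (φ-mono v̂ v̂∈ (strictCarrierGame-monotone Δ (value T)))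
         (≃-trans {φv̂} {∑v̂} {p T} (φ≃∑ v̂ v̂∈)
           (∑Lk-strictCarrierGame Δ i p T i∉t))
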